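{- For every non-negative integer $m$ and positive integer $n$, $$\sum_{k=1}^n\frac{H_{n-k}(m)}{k(k+1)}=H_n(m)+H_n(m+1)-H_{n+1}(m+1).$$ In particular, $\sum_{k=1}^n\frac{H_{n-k}}{k(k+1)}=H_n+H_n^2-H_n^{(2)}-H_{n+1}^2+H_{n+1}^{(2)}$.
   Context: For integers $m\ge 1$, $n\ge 0$, the multiple harmonic-like numbers are $H_n(m)=\sum_{1\le k_1+k_2+\cdots+k_m\le n}\frac{1}{k_1k_2\cdots k_m}$ (sum over positive integers $k_1,\dots,k_m$), with $H_n(0)=1$ for $n\ge 0$ and $H_0(m)=0$ for $m\ge1$. $H_n=H_n(1)=\sum_{k=1}^n\frac1k$, $H_n^{(2)}=\sum_{k=1}^n\frac1{k^2}$. -}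

module Defs where

open import Data.Fin.Base using (Fin; toℕ)
open import Data.Integer.Base using (+_)
open import Data.List.Base as List using (List; []; _∷_; [_]; cartesianProductWith; filter)
open import Data.Nat.Base using (ℕ; zero; suc; NonZero; _≤_)
import Data.Nat.Base as ℕ
open import Data.Nat.Properties using (m*n≢0; _≤?_)
open import Data.Product.Base using (_×_)
open import Data.Rational.Base using (ℚ; 0ℚ; 1ℚ; _+_; _*_; _/_)
open import Data.Vec.Base as Vec using (Vec; []; _∷_)
open import Relation.Nullary.Decidable using (Dec; _×-dec_)

infixl 7 _÷ℕ_

_÷ℕ_ : ℚ → (d : ℕ) .{{_ : NonZero d}} → ℚ
q ÷ℕ d = q * (+ 1 / d)

-- ∑₁ n f = f 1 + ⋯ + f n
∑₁ : ℕ → ((k : ℕ) .{{_ : NonZero k}} → ℚ) → ℚ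
∑₁ zero    f = 0ℚ
∑₁ (suc n) f = ∑₁ n f + f (suc n)

∑ᴸ : ∀ {A : Set} → List A → (A → ℚ) → ℚ
∑ᴸ xs f = List.foldr (λ x s → f x + s) 0ℚ xs

-- An element of Vec (Fin n) m encodes a tuple (k₁, …, kₘ) with 1 ≤ kᵢ ≤ n,
-- the index i : Fin n standing for the positive integer 1 + toℕ i.
pos : ∀ {n} → Fin n → ℕ
pos i = suc (toℕ i)

tupleSum : ∀ {n m} → Vec (Fin n) m → ℕ
tupleSum ks = Vec.sum (Vec.map pos ks)

tupleProduct : ∀ {n m} → Vec (Fin n) m → ℕ
tupleProduct []       = 1
tupleProduct (k ∷ ks) = pos k ℕ.* tupleProduct ks

tupleProduct≢0 : ∀ {n m} (ks : Vec (Fin n) m) → NonZero (tupleProduct ks)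
tupleProduct≢0 []       = _
tupleProduct≢0 (k ∷ ks) = m*n≢0 (pos k) (tupleProduct ks) {{_}} {{tupleProduct≢0 ks}}

allTuples : ∀ n m → List (Vec (Fin n) m)
allTuples n zero    = [ [] ]
allTuples n (suc m) = cartesianProductWith _∷_ (List.allFin n) (allTuples n m)

Admissible : ∀ {n m} → Vec (Fin n) m → Set
Admissible {n} ks = 1 ≤ tupleSum ks × tupleSum ks ≤ n

admissible? : ∀ {n m} (ks : Vec (Fin n) m) → Dec (Admissible ks)
admissible? {n} ks = (1 ≤? tupleSum ks) ×-dec (tupleSum ks ≤? n)

-- H n m is the multiple harmonic-like number Hₙ(m).  Positive integers whose
-- sum is at most n are each at most n, so restricting the range of the kᵢ to
-- {1, …, n} omits no term.  For m = 0 the value 1 is a convention.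
H : ℕ → ℕ → ℚ
H n zero    = 1ℚ
H n (suc m) = ∑ᴸ (filter admissible? (allTuples n (suc m))) λ ks →
  (1ℚ ÷ℕ tupleProduct ks) {{tupleProduct≢0 ks}}

harmonic : ℕ → ℚ
harmonic n = ∑₁ n λ k → 1ℚ ÷ℕ k

harmonic⁽²⁾ : ℕ → ℚ
harmonic⁽²⁾ n = ∑₁ n λ k → (1ℚ ÷ℕ (k ℕ.* k)) {{m*n≢0 k k}}

{-# OPTIONS --safe #-}
-- Splitting off the first entry of a tuple gives the recurrence
--   Hₙ(m+1) = ∑_{k=1}^n Hₙ₋ₖ(m) / k,
-- so Hₙ(m+1) is the convolution of n ↦ Hₙ(m) with k ↦ 1/k.  For an arbitrary
-- sequence a, the partial fraction 1/(k(k+1)) = 1/k − 1/(k+1) expresses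
-- ∑ aₙ₋ₖ/(k(k+1)) through the convolutions of a at n and n + 1; this is the
-- first formula.  For a = (Hₙ) the two convolutions differ by
-- ∑_{k=1}^n 1/(k(n+1−k)) = 2Hₙ/(n+1), which is also the increment of
-- Hₙ² − Hₙ⁽²⁾; this is the second formula.
module Submission where

open import Defs
open import Data.Bool.Base using (true; false; if_then_else_)
open import Data.Fin.Base using (Fin; zero; suc)
import Data.Integer.Base as ℤ
import Data.Integer.Tactic.RingSolver as ℤ-Solver
open import Data.List.Base as List using (List; []; _∷_; _++_; cartesianProductWith; filter)
open import Data.Nat.Base using (ℕ; zero; suc; NonZero; _≤_; _<_; _∸_; _≤′_; ≤′-reflexive; ≤′-step)
import Data.Nat.Base as ℕ
open import Data.Nat.Properties using (m*n≢0; _≤?_)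
import Data.Nat.Properties as ℕ
open import Data.Product.Base using (_×_; _,_)
open import Data.Rational.Base using (ℚ; 0ℚ; 1ℚ; toℚᵘ; _+_; _-_; _*_; _/_)
open import Data.Rational.Properties as ℚ using (toℚᵘ-injective; toℚᵘ-fromℚᵘ; toℚᵘ-homo-+; toℚᵘ-homo-*)
import Data.Rational.Unnormalised.Base as ℚᵘ
import Data.Rational.Unnormalised.Properties as ℚᵘ
open import Data.Rational.Solver using (module +-*-Solver)
open import Data.Vec.Base using (Vec; []; _∷_)
open import Function.Base using (_∘_; id)
open import Function.Bundles using (mk⇔)
open import Relation.Binary.PropositionalEquality using (_≡_; refl; sym; trans; cong; cong₂; subst; module ≡-Reasoning)
open import Relation.Nullary.Decidable using (does; yes; no; does-⇔; dec-true; dec-false)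
open import Relation.Unary using (Pred; Decidable)

open +-*-Solver using (solve; _:+_; _:*_; _:-_; _:=_; con)
open ≡-Reasoning

-- Unit fractions

1/_ : (k : ℕ) .{{_ : NonZero k}} → ℚ
1/ k = ℤ.+ 1 / k

-- `_/_` divides out a gcd and is stuck on a variable denominator. In the unnormalised rationals an
-- identity of unit fractions becomes a cross-multiplied equation of integers.
toℚᵘ-1/ : ∀ k → toℚᵘ (1/ suc k) ℚᵘ.≃ ℚᵘ.mkℚᵘ (ℤ.+ 1) k
toℚᵘ-1/ k = toℚᵘ-fromℚᵘ (ℚᵘ.mkℚᵘ (ℤ.+ 1) k)

1/-* : ∀ a b .{{_ : NonZero a}} .{{_ : NonZero b}} .{{_ : NonZero (a ℕ.* b)}} →
       1/ (a ℕ.* b) ≡ 1/ a * 1/ b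
1/-* (suc a) (suc b) = toℚᵘ-injective (ℚᵘ.≃-trans (toℚᵘ-1/ (b ℕ.+ a ℕ.* suc b))
  (ℚᵘ.≃-sym (ℚᵘ.≃-trans (toℚᵘ-homo-* (1/ suc a) (1/ suc b))
    (ℚᵘ.≃-trans (ℚᵘ.*-cong (toℚᵘ-1/ a) (toℚᵘ-1/ b)) (ℚᵘ.*≡* refl)))))

-- Partial fractions: 1/x + 1/y = (x + y)/(xy). The case x = 1 gives the telescoping identity;
-- denominators with x + y = n + 1 give the symmetric sum `∑₁-1/-*-1/`.
1/-*-+ : ∀ a b → 1/ suc a * 1/ suc b ≡ (1/ suc a + 1/ suc b) * 1/ (suc a ℕ.+ suc b)
1/-*-+ a b = toℚᵘ-injective (ℚᵘ.≃-trans (toℚᵘ-homo-* (1/ suc a) (1/ suc b))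
  (ℚᵘ.≃-trans (ℚᵘ.*-cong (toℚᵘ-1/ a) (toℚᵘ-1/ b))
  (ℚᵘ.≃-trans (ℚᵘ.*≡* (cross (ℤ.+ suc a) (ℤ.+ suc b)))
  (ℚᵘ.≃-sym (ℚᵘ.≃-trans (toℚᵘ-homo-* (1/ suc a + 1/ suc b) (1/ (suc a ℕ.+ suc b)))
    (ℚᵘ.*-cong (ℚᵘ.≃-trans (toℚᵘ-homo-+ (1/ suc a) (1/ suc b)) (ℚᵘ.+-cong (toℚᵘ-1/ a) (toℚᵘ-1/ b)))
               (toℚᵘ-1/ (a ℕ.+ suc b))))))))
  where
  cross : ∀ x y → (ℤ.+ 1 ℤ.* ℤ.+ 1) ℤ.* ((x ℤ.* y) ℤ.* (x ℤ.+ y))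
                ≡ ((ℤ.+ 1 ℤ.* y ℤ.+ ℤ.+ 1 ℤ.* x) ℤ.* ℤ.+ 1) ℤ.* (x ℤ.* y)
  cross = ℤ-Solver.solve-∀

1/-telescope : ∀ k .{{_ : NonZero k}} .{{_ : NonZero (k ℕ.* suc k)}} →
               1/ (k ℕ.* suc k) + 1/ suc k ≡ 1/ k
1/-telescope (suc k) = begin
  1/ (suc k ℕ.* suc (suc k)) + s   ≡⟨ cong (_+ s) (1/-* (suc k) (suc (suc k))) ⟩
  r * s + s                        ≡⟨ solve 2 (λ r s → r :* s :+ s := (con 1ℚ :+ r) :* s) refl r s ⟩
  -- The first denominator is 1, and `1/ 1` evaluates to `1ℚ`.
  (1ℚ + r) * s                     ≡⟨ 1/-*-+ 0 k ⟨
  1ℚ * r                           ≡⟨ ℚ.*-identityˡ r ⟩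
  r                                ∎
  where
  r = 1/ suc k
  s = 1/ suc (suc k)

-- Finite sums

∑₁-cong : ∀ n {f g : (k : ℕ) .{{_ : NonZero k}} → ℚ} →
          (∀ k → k < n → f (suc k) ≡ g (suc k)) → ∑₁ n f ≡ ∑₁ n g
∑₁-cong zero    eq = refl
∑₁-cong (suc n) eq = cong₂ _+_ (∑₁-cong n λ k k<n → eq k (ℕ.m<n⇒m<1+n k<n)) (eq n ℕ.≤-refl)

∑₁-+ : ∀ n (f g : (k : ℕ) .{{_ : NonZero k}} → ℚ) →
       ∑₁ n (λ k → f k + g k) ≡ ∑₁ n f + ∑₁ n g
∑₁-+ zero    f g = refl
∑₁-+ (suc n) f g = trans (cong (_+ (f (suc n) + g (suc n))) (∑₁-+ n f g))
  (solve 4 (λ a b c d → (a :+ b) :+ (c :+ d) := (a :+ c) :+ (b :+ d)) refl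
    (∑₁ n f) (∑₁ n g) (f (suc n)) (g (suc n)))

∑₁-*ʳ : ∀ n (f : (k : ℕ) .{{_ : NonZero k}} → ℚ) c → ∑₁ n (λ k → f k * c) ≡ ∑₁ n f * c
∑₁-*ʳ zero    f c = sym (ℚ.*-zeroˡ c)
∑₁-*ʳ (suc n) f c = trans (cong (_+ f (suc n) * c) (∑₁-*ʳ n f c))
  (sym (ℚ.*-distribʳ-+ c (∑₁ n f) (f (suc n))))

∑₁-head : ∀ n (f : (k : ℕ) .{{_ : NonZero k}} → ℚ) →
          ∑₁ (suc n) f ≡ f 1 + ∑₁ n (λ k → f (suc k))
∑₁-head zero    f = ℚ.+-comm 0ℚ (f 1)
∑₁-head (suc n) f = trans (cong (_+ f (suc (suc n))) (∑₁-head n f))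
  (ℚ.+-assoc (f 1) (∑₁ n (λ k → f (suc k))) (f (suc (suc n))))

∑₁-reverse : ∀ n (f : (k : ℕ) .{{_ : NonZero k}} → ℚ) →
             ∑₁ n (λ k → f (suc (n ∸ k))) ≡ ∑₁ n f
∑₁-reverse zero    f = refl
∑₁-reverse (suc n) f = begin
  ∑₁ (suc n) (λ k → f (suc (suc n ∸ k)))      ≡⟨ ∑₁-head n (λ k → f (suc (suc n ∸ k))) ⟩
  f (suc n) + ∑₁ n (λ k → f (suc (n ∸ k)))    ≡⟨ cong (f (suc n) +_) (∑₁-reverse n f) ⟩
  f (suc n) + ∑₁ n f                          ≡⟨ ℚ.+-comm (f (suc n)) (∑₁ n f) ⟩
  ∑₁ n f + f (suc n)                          ∎

∑₁-truncate : ∀ {n N} (f : (k : ℕ) .{{_ : NonZero k}} → ℚ) → n ≤′ N →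
              (∀ k → n ≤ k → f (suc k) ≡ 0ℚ) → ∑₁ N f ≡ ∑₁ n f
∑₁-truncate f (≤′-reflexive refl) zeros = refl
∑₁-truncate {n} f (≤′-step {N} n≤N) zeros = begin
  ∑₁ N f + f (suc N)   ≡⟨ cong₂ _+_ (∑₁-truncate f n≤N zeros) (zeros N (ℕ.≤′⇒≤ n≤N)) ⟩
  ∑₁ n f + 0ℚ          ≡⟨ ℚ.+-identityʳ (∑₁ n f) ⟩
  ∑₁ n f               ∎

module _ {A : Set} where

  ∑ᴸ-cong : ∀ (xs : List A) {f g : A → ℚ} → (∀ x → f x ≡ g x) → ∑ᴸ xs f ≡ ∑ᴸ xs g
  ∑ᴸ-cong []       eq = refl
  ∑ᴸ-cong (x ∷ xs) eq = cong₂ _+_ (eq x) (∑ᴸ-cong xs eq)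

  ∑ᴸ-zero : ∀ (xs : List A) → ∑ᴸ xs (λ _ → 0ℚ) ≡ 0ℚ
  ∑ᴸ-zero []       = refl
  ∑ᴸ-zero (x ∷ xs) = trans (ℚ.+-identityˡ _) (∑ᴸ-zero xs)

  ∑ᴸ-*ʳ : ∀ (xs : List A) (f : A → ℚ) c → ∑ᴸ xs (λ x → f x * c) ≡ ∑ᴸ xs f * c
  ∑ᴸ-*ʳ []       f c = sym (ℚ.*-zeroˡ c)
  ∑ᴸ-*ʳ (x ∷ xs) f c = trans (cong (f x * c +_) (∑ᴸ-*ʳ xs f c))
    (sym (ℚ.*-distribʳ-+ c (f x) (∑ᴸ xs f)))

  ∑ᴸ-++ : ∀ (xs ys : List A) (f : A → ℚ) → ∑ᴸ (xs ++ ys) f ≡ ∑ᴸ xs f + ∑ᴸ ys f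
  ∑ᴸ-++ []       ys f = sym (ℚ.+-identityˡ (∑ᴸ ys f))
  ∑ᴸ-++ (x ∷ xs) ys f = trans (cong (f x +_) (∑ᴸ-++ xs ys f))
    (sym (ℚ.+-assoc (f x) (∑ᴸ xs f) (∑ᴸ ys f)))

  ∑ᴸ-map : ∀ {B : Set} (g : B → A) (xs : List B) (f : A → ℚ) →
           ∑ᴸ (List.map g xs) f ≡ ∑ᴸ xs (f ∘ g)
  ∑ᴸ-map g []       f = refl
  ∑ᴸ-map g (x ∷ xs) f = cong (f (g x) +_) (∑ᴸ-map g xs f)

  -- Turning the filter into a zero summand leaves the whole cartesian product as index set, so the
  -- first entry can be split off.
  ∑ᴸ-filter : ∀ {p} {P : Pred A p} (P? : Decidable P) (xs : List A) (f : A → ℚ) →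
              ∑ᴸ (filter P? xs) f ≡ ∑ᴸ xs (λ x → if does (P? x) then f x else 0ℚ)
  ∑ᴸ-filter P? []       f = refl
  ∑ᴸ-filter P? (x ∷ xs) f with does (P? x)
  ... | true  = cong (f x +_) (∑ᴸ-filter P? xs f)
  ... | false = trans (∑ᴸ-filter P? xs f) (sym (ℚ.+-identityˡ _))

  ∑ᴸ-tabulate : ∀ n (h : Fin n → A) (f : A → ℚ) (g : (k : ℕ) .{{_ : NonZero k}} → ℚ) →
                (∀ i → f (h i) ≡ g (pos i)) → ∑ᴸ (List.tabulate h) f ≡ ∑₁ n g
  ∑ᴸ-tabulate zero    h f g eq = refl
  ∑ᴸ-tabulate (suc n) h f g eq = trans
    (cong₂ _+_ (eq zero) (∑ᴸ-tabulate n (h ∘ suc) f (λ k → g (suc k)) (eq ∘ suc)))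
    (sym (∑₁-head n g))

∑ᴸ-cartesianProductWith : ∀ {A B C : Set} (g : A → B → C) xs ys (f : C → ℚ) →
  ∑ᴸ (cartesianProductWith g xs ys) f ≡ ∑ᴸ xs (λ x → ∑ᴸ ys (λ y → f (g x y)))
∑ᴸ-cartesianProductWith g []       ys f = refl
∑ᴸ-cartesianProductWith g (x ∷ xs) ys f = trans
  (∑ᴸ-++ (List.map (g x) ys) (cartesianProductWith g xs ys) f)
  (cong₂ _+_ (∑ᴸ-map (g x) ys f) (∑ᴸ-cartesianProductWith g xs ys f))

-- The recurrence for H

-- The coefficient of x^n in A(x) · (-log(1 - x)), where A is the generating function of `a`.
convolution : (ℕ → ℚ) → ℕ → ℚ
convolution a n = ∑₁ n λ k → a (n ∸ k) ÷ℕ k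

1/tupleProduct : ∀ {N m} → Vec (Fin N) m → ℚ
1/tupleProduct ks = (1ℚ ÷ℕ tupleProduct ks) {{tupleProduct≢0 ks}}

-- Only the upper bound is tested, so the empty tuple contributes 1, in agreement with the
-- convention for `H n 0`.
term : ∀ {N m} → ℕ → Vec (Fin N) m → ℚ
term n ks = if does (tupleSum ks ≤? n) then 1/tupleProduct ks else 0ℚ

-- H n m with the range {1, …, N} of the entries decoupled from the bound n on
-- their sum, which the recurrence changes while N stays fixed.
boundedH : ℕ → ℕ → ℕ → ℚ
boundedH N n m = ∑ᴸ (allTuples N m) (term n)

H≡boundedH : ∀ n m → H n m ≡ boundedH n n m
H≡boundedH n zero    = refl
H≡boundedH n (suc m) = trans (∑ᴸ-filter admissible? (allTuples n (suc m)) 1/tupleProduct)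
  (∑ᴸ-cong (allTuples n (suc m)) admissible-term)
  where
  admissible-term : ∀ ks → (if does (admissible? ks) then 1/tupleProduct ks else 0ℚ) ≡ term n ks
  -- The sum of a nonempty tuple is a successor, so the test `1 ≤?` evaluates to true.
  admissible-term (_ ∷ _) = refl

if-*ʳ : ∀ b q c → (if b then q * c else 0ℚ) ≡ (if b then q else 0ℚ) * c
if-*ʳ true  q c = refl
if-*ʳ false q c = sym (ℚ.*-zeroˡ c)

1/tupleProduct-∷ : ∀ {N m} (i : Fin N) (ks : Vec (Fin N) m) →
                   1/tupleProduct (i ∷ ks) ≡ 1/tupleProduct ks ÷ℕ pos i
1/tupleProduct-∷ i ks = begin
  1ℚ * 1/ (pos i ℕ.* tupleProduct ks)           ≡⟨ cong (1ℚ *_) (1/-* (pos i) (tupleProduct ks)) ⟩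
  1ℚ * (1/ pos i * 1/ tupleProduct ks)          ≡⟨ solve 2 (λ a b → con 1ℚ :* (a :* b) := (con 1ℚ :* b) :* a)
                                                     refl (1/ pos i) (1/ tupleProduct ks) ⟩
  1/tupleProduct ks ÷ℕ pos i                    ∎
  where instance
  _ = tupleProduct≢0 ks
  _ = tupleProduct≢0 (i ∷ ks)

-- k₁ + s ≤ n is equivalent to s ≤ n - k₁. For k₁ > n truncated subtraction would give 0 and wrongly
-- admit an empty tail.
term-∷-≤ : ∀ {N m} n (i : Fin N) (ks : Vec (Fin N) m) → pos i ≤ n →
           term n (i ∷ ks) ≡ term (n ∸ pos i) ks ÷ℕ pos i
term-∷-≤ n i ks i≤n = begin
  (if does (pos i ℕ.+ s ≤? n) then 1/tupleProduct (i ∷ ks) else 0ℚ)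
    ≡⟨ cong₂ (λ b q → if b then q else 0ℚ)
          (does-⇔ (mk⇔ to from) (pos i ℕ.+ s ≤? n) (s ≤? n ∸ pos i)) (1/tupleProduct-∷ i ks) ⟩
  (if does (s ≤? n ∸ pos i) then 1/tupleProduct ks ÷ℕ pos i else 0ℚ)
    ≡⟨ if-*ʳ (does (s ≤? n ∸ pos i)) (1/tupleProduct ks) (1/ pos i) ⟩
  term (n ∸ pos i) ks ÷ℕ pos i ∎
  where
  s = tupleSum ks
  to : pos i ℕ.+ s ≤ n → s ≤ n ∸ pos i
  to le = ℕ.m+n≤o⇒m≤o∸n s (subst (_≤ n) (ℕ.+-comm (pos i) s) le)
  from : s ≤ n ∸ pos i → pos i ℕ.+ s ≤ n
  from le = subst (_≤ n) (ℕ.+-comm s (pos i)) (ℕ.m≤o∸n⇒m+n≤o s i≤n le)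

term-∷-> : ∀ {N m} n (i : Fin N) (ks : Vec (Fin N) m) → n < pos i → term n (i ∷ ks) ≡ 0ℚ
term-∷-> n i ks n<i = cong (λ b → if b then 1/tupleProduct (i ∷ ks) else 0ℚ)
  (dec-false (pos i ℕ.+ tupleSum ks ≤? n) λ le → ℕ.<⇒≱ n<i (ℕ.m+n≤o⇒m≤o (pos i) le))

-- Sum over the tails for each fixed first entry k. Entries k > n contribute zero, which cuts the
-- range from N down to n.
boundedH-suc : ∀ {N n} m → n ≤ N → boundedH N n (suc m) ≡ convolution (λ j → boundedH N j m) n
boundedH-suc {N} {n} m n≤N = begin
  ∑ᴸ (allTuples N (suc m)) (term n)
    ≡⟨ ∑ᴸ-cartesianProductWith _∷_ (List.allFin N) (allTuples N m) (term n) ⟩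
  ∑ᴸ (List.allFin N) (λ i → ∑ᴸ (allTuples N m) (λ ks → term n (i ∷ ks)))
    ≡⟨ ∑ᴸ-tabulate N id _ g inner ⟩
  ∑₁ N g
    ≡⟨ ∑₁-truncate g (ℕ.≤⇒≤′ n≤N) beyond ⟩
  ∑₁ n g
    ≡⟨ ∑₁-cong n within ⟩
  convolution (λ j → boundedH N j m) n ∎
  where
  g : (k : ℕ) .{{_ : NonZero k}} → ℚ
  -- The guard matters for m = 0: at k > n the truncated `n ∸ k` is 0, and `boundedH N 0 0` is 1.
  g k = if does (k ≤? n) then boundedH N (n ∸ k) m ÷ℕ k else 0ℚ

  beyond : ∀ k → n ≤ k → g (suc k) ≡ 0ℚ
  beyond k n≤k = cong (λ b → if b then boundedH N (n ∸ suc k) m ÷ℕ suc k else 0ℚ)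
    (dec-false (suc k ≤? n) (ℕ.<⇒≱ (ℕ.s≤s n≤k)))

  within : ∀ k → k < n → g (suc k) ≡ boundedH N (n ∸ suc k) m ÷ℕ suc k
  within k k<n = cong (λ b → if b then boundedH N (n ∸ suc k) m ÷ℕ suc k else 0ℚ)
    (dec-true (suc k ≤? n) k<n)

  inner : ∀ i → ∑ᴸ (allTuples N m) (λ ks → term n (i ∷ ks)) ≡ g (pos i)
  inner i with pos i ≤? n
  ... | yes i≤n = begin
    ∑ᴸ (allTuples N m) (λ ks → term n (i ∷ ks))
      ≡⟨ ∑ᴸ-cong (allTuples N m) (λ ks → term-∷-≤ n i ks i≤n) ⟩
    ∑ᴸ (allTuples N m) (λ ks → term (n ∸ pos i) ks ÷ℕ pos i)
      ≡⟨ ∑ᴸ-*ʳ (allTuples N m) (term (n ∸ pos i)) (1/ pos i) ⟩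
    boundedH N (n ∸ pos i) m ÷ℕ pos i
      ≡⟨ within _ i≤n ⟨
    g (pos i) ∎
  ... | no i≰n = begin
    ∑ᴸ (allTuples N m) (λ ks → term n (i ∷ ks))
      ≡⟨ ∑ᴸ-cong (allTuples N m) (λ ks → term-∷-> n i ks (ℕ.≰⇒> i≰n)) ⟩
    ∑ᴸ (allTuples N m) (λ _ → 0ℚ)
      ≡⟨ ∑ᴸ-zero (allTuples N m) ⟩
    0ℚ
      ≡⟨ beyond _ (ℕ.≤-pred (ℕ.≰⇒> i≰n)) ⟨
    g (pos i) ∎

convolution-cong : ∀ {a b : ℕ → ℚ} n → (∀ j → j ≤ n → a j ≡ b j) →
                   convolution a n ≡ convolution b n
convolution-cong n eq = ∑₁-cong n λ k _ → cong (_÷ℕ suc k) (eq (n ∸ suc k) (ℕ.m∸n≤m n (suc k)))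

-- The ranges N and n obey the same recurrence, so induction on m identifies them. This is needed
-- because the tails of tuples over {1, ..., n} keep that range, while `H j m` uses {1, ..., j}.
boundedH≡H : ∀ {N n} m → n ≤ N → boundedH N n m ≡ H n m
boundedH≡H         zero    n≤N = refl
boundedH≡H {N} {n} (suc m) n≤N = begin
  boundedH N n (suc m)                   ≡⟨ boundedH-suc m n≤N ⟩
  convolution (λ j → boundedH N j m) n   ≡⟨ convolution-cong n (λ j j≤n → trans
                                              (boundedH≡H m (ℕ.≤-trans j≤n n≤N)) (sym (boundedH≡H m j≤n))) ⟩
  convolution (λ j → boundedH n j m) n   ≡⟨ boundedH-suc {n} m ℕ.≤-refl ⟨
  boundedH n n (suc m)                   ≡⟨ H≡boundedH n (suc m) ⟨
  H n (suc m)                            ∎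

H-suc : ∀ n m → H n (suc m) ≡ convolution (λ j → H j m) n
H-suc n m = begin
  H n (suc m)                            ≡⟨ H≡boundedH n (suc m) ⟩
  boundedH n n (suc m)                   ≡⟨ boundedH-suc {n} m ℕ.≤-refl ⟩
  convolution (λ j → boundedH n j m) n   ≡⟨ convolution-cong n (λ _ → boundedH≡H m) ⟩
  convolution (λ j → H j m) n            ∎

-- The two summation formulas

∑₁-÷ℕ-k[k+1] : ∀ (a : ℕ → ℚ) n →
  ∑₁ n (λ k → (a (n ∸ k) ÷ℕ (k ℕ.* suc k)) {{m*n≢0 k (suc k)}})
    ≡ a n + convolution a n - convolution a (suc n)
∑₁-÷ℕ-k[k+1] a n = begin
  -- S + T is the convolution at n by telescoping, and a n + T is the one at n + 1.
  S                                               ≡⟨ solve 3 (λ x s t → s := x :+ (s :+ t) :- (x :+ t)) refl (a n) S T ⟩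
  a n + (S + T) - (a n + T)                       ≡⟨ cong₂ (λ u v → a n + u - v) S+T (sym head) ⟩
  a n + convolution a n - convolution a (suc n)   ∎
  where
  S T : ℚ
  S = ∑₁ n (λ k → (a (n ∸ k) ÷ℕ (k ℕ.* suc k)) {{m*n≢0 k (suc k)}})
  T = ∑₁ n (λ k → a (n ∸ k) ÷ℕ suc k)

  -- The k = 1 term is a n; shifting the index of the others gives T.
  head : convolution a (suc n) ≡ a n + T
  head = trans (∑₁-head n (λ k → a (suc n ∸ k) ÷ℕ k)) (cong (_+ T) (ℚ.*-identityʳ (a n)))

  S+T : S + T ≡ convolution a n
  S+T = trans
    (sym (∑₁-+ n (λ k → (a (n ∸ k) ÷ℕ (k ℕ.* suc k)) {{m*n≢0 k (suc k)}}) (λ k → a (n ∸ k) ÷ℕ suc k)))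
    (∑₁-cong n λ k _ → trans
      (sym (ℚ.*-distribˡ-+ (a (n ∸ suc k)) (1/ (suc k ℕ.* suc (suc k))) (1/ suc (suc k))))
      (cong (a (n ∸ suc k) *_) (1/-telescope (suc k))))

harmonic-1/ : ∀ n → harmonic n ≡ ∑₁ n 1/_
harmonic-1/ n = ∑₁-cong n λ k _ → ℚ.*-identityˡ (1/ suc k)

-- The denominators n + 1 - k and k add up to n + 1. After partial fractions, reversing one of the
-- two sums makes both equal to Hₙ.
∑₁-1/-*-1/ : ∀ n → ∑₁ n (λ k → 1/ suc (n ∸ k) * 1/ k) ≡ (harmonic n + harmonic n) ÷ℕ suc n
∑₁-1/-*-1/ n = begin
  ∑₁ n (λ k → 1/ suc (n ∸ k) * 1/ k)
    ≡⟨ ∑₁-cong n split ⟩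
  ∑₁ n (λ k → (1/ suc (n ∸ k) + 1/ k) * 1/ suc n)
    ≡⟨ ∑₁-*ʳ n (λ k → 1/ suc (n ∸ k) + 1/ k) (1/ suc n) ⟩
  ∑₁ n (λ k → 1/ suc (n ∸ k) + 1/ k) * 1/ suc n
    ≡⟨ cong (_* 1/ suc n) (∑₁-+ n (λ k → 1/ suc (n ∸ k)) 1/_) ⟩
  (∑₁ n (λ k → 1/ suc (n ∸ k)) + ∑₁ n 1/_) * 1/ suc n
    ≡⟨ cong (λ s → (s + ∑₁ n 1/_) * 1/ suc n) (∑₁-reverse n 1/_) ⟩
  (∑₁ n 1/_ + ∑₁ n 1/_) * 1/ suc n
    ≡⟨ cong (λ h → (h + h) * 1/ suc n) (harmonic-1/ n) ⟨
  (harmonic n + harmonic n) ÷ℕ suc n ∎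
  where
  split : ∀ k → k < n → 1/ suc (n ∸ suc k) * 1/ suc k ≡ (1/ suc (n ∸ suc k) + 1/ suc k) * 1/ suc n
  split k k<n = trans (1/-*-+ (n ∸ suc k) k)
    (cong (λ j → (1/ suc (n ∸ suc k) + 1/ suc k) * 1/ suc j) (ℕ.m∸n+n≡m k<n))

-- For k ≤ n, Hₙ₊₁₋ₖ exceeds Hₙ₋ₖ by 1/(n + 1 - k); the term k = n + 1 vanishes since H₀ = 0.
convolution-harmonic-suc : ∀ n → convolution harmonic (suc n)
  ≡ convolution harmonic n + (harmonic n + harmonic n) ÷ℕ suc n
convolution-harmonic-suc n = begin
  ∑₁ n (λ k → harmonic (suc n ∸ k) ÷ℕ k) + harmonic (n ∸ n) ÷ℕ suc n
    ≡⟨ cong₂ _+_ (∑₁-cong n step) last ⟩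
  ∑₁ n (λ k → harmonic (n ∸ k) ÷ℕ k + 1/ suc (n ∸ k) * 1/ k) + 0ℚ
    ≡⟨ ℚ.+-identityʳ _ ⟩
  ∑₁ n (λ k → harmonic (n ∸ k) ÷ℕ k + 1/ suc (n ∸ k) * 1/ k)
    ≡⟨ ∑₁-+ n (λ k → harmonic (n ∸ k) ÷ℕ k) (λ k → 1/ suc (n ∸ k) * 1/ k) ⟩
  convolution harmonic n + ∑₁ n (λ k → 1/ suc (n ∸ k) * 1/ k)
    ≡⟨ cong (convolution harmonic n +_) (∑₁-1/-*-1/ n) ⟩
  convolution harmonic n + (harmonic n + harmonic n) ÷ℕ suc n ∎
  where
  last : harmonic (n ∸ n) ÷ℕ suc n ≡ 0ℚ
  last = trans (cong (λ j → harmonic j ÷ℕ suc n) (ℕ.n∸n≡0 n)) (ℚ.*-zeroˡ (1/ suc n))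

  step : ∀ k → k < n → harmonic (n ∸ k) ÷ℕ suc k
       ≡ harmonic (n ∸ suc k) ÷ℕ suc k + 1/ suc (n ∸ suc k) * 1/ suc k
  step k k<n = begin
    harmonic (n ∸ k) ÷ℕ suc k
      -- `k < n` exposes `n ∸ k` as a successor, on which `harmonic` unfolds.
      ≡⟨ cong (λ j → harmonic j ÷ℕ suc k) (ℕ.+-∸-assoc 1 k<n) ⟩
    (harmonic (n ∸ suc k) + 1ℚ ÷ℕ suc (n ∸ suc k)) ÷ℕ suc k
      ≡⟨ solve 3 (λ h r s → (h :+ con 1ℚ :* r) :* s := h :* s :+ r :* s) refl
           (harmonic (n ∸ suc k)) (1/ suc (n ∸ suc k)) (1/ suc k) ⟩
    harmonic (n ∸ suc k) ÷ℕ suc k + 1/ suc (n ∸ suc k) * 1/ suc k ∎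

theorem8 : ((m n : ℕ) → 1 ≤ n →
    ∑₁ n (λ k → (H (n ∸ k) m ÷ℕ (k ℕ.* suc k)) {{m*n≢0 k (suc k)}})
    ≡ H n m + H n (suc m) - H (suc n) (suc m))
    ×
    ((n : ℕ) → 1 ≤ n →
    ∑₁ n (λ k → (harmonic (n ∸ k) ÷ℕ (k ℕ.* suc k)) {{m*n≢0 k (suc k)}})
    ≡ harmonic n + harmonic n * harmonic n - harmonic⁽²⁾ n
    - harmonic (suc n) * harmonic (suc n) + harmonic⁽²⁾ (suc n))
theorem8 = part₁ , part₂
  where
  part₁ : (m n : ℕ) → 1 ≤ n →
    ∑₁ n (λ k → (H (n ∸ k) m ÷ℕ (k ℕ.* suc k)) {{m*n≢0 k (suc k)}})
    ≡ H n m + H n (suc m) - H (suc n) (suc m)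
  part₁ m n _ = trans (∑₁-÷ℕ-k[k+1] (λ j → H j m) n)
    (sym (cong₂ (λ u v → H n m + u - v) (H-suc n m) (H-suc (suc n) m)))

  part₂ : (n : ℕ) → 1 ≤ n →
    ∑₁ n (λ k → (harmonic (n ∸ k) ÷ℕ (k ℕ.* suc k)) {{m*n≢0 k (suc k)}})
    ≡ harmonic n + harmonic n * harmonic n - harmonic⁽²⁾ n
    - harmonic (suc n) * harmonic (suc n) + harmonic⁽²⁾ (suc n)
  part₂ n _ = begin
    ∑₁ n (λ k → (harmonic (n ∸ k) ÷ℕ (k ℕ.* suc k)) {{m*n≢0 k (suc k)}})
      ≡⟨ ∑₁-÷ℕ-k[k+1] harmonic n ⟩
    h + c - convolution harmonic (suc n)
      ≡⟨ cong (λ x → h + c - x) (convolution-harmonic-suc n) ⟩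
    h + c - (c + (h + h) * r)
      -- `harmonic (suc n)` unfolds to `h + 1ℚ * r`. Both `c` and `h₂` cancel, and each side equals
      -- h - 2hr.
      ≡⟨ solve 4 (λ h h₂ c r → h :+ c :- (c :+ (h :+ h) :* r)
           := h :+ h :* h :- h₂ :- (h :+ con 1ℚ :* r) :* (h :+ con 1ℚ :* r) :+ (h₂ :+ con 1ℚ :* (r :* r)))
           refl h h₂ c r ⟩
    h + h * h - h₂ - harmonic (suc n) * harmonic (suc n) + (h₂ + 1ℚ * (r * r))
      ≡⟨ cong (λ x → h + h * h - h₂ - harmonic (suc n) * harmonic (suc n) + (h₂ + 1ℚ * x))
           (1/-* (suc n) (suc n)) ⟨
    h + h * h - h₂ - harmonic (suc n) * harmonic (suc n) + harmonic⁽²⁾ (suc n) ∎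
    where
    h h₂ c r : ℚ
    h = harmonic n
    h₂ = harmonic⁽²⁾ n
    c = convolution harmonic n
    r = 1/ suc n
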